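{- For every maximal outerplanar graph $G$, $$\gamma(G) \leq \min\left\{3\rho(G),\ \tfrac{9}{4}\rho(G) + \tfrac{t}{4}\right\},$$ where $t$ is the number of vertices of degree at most $3$ in $G$.
   Context: All graphs are finite and simple. A graph is outerplanar if it has a plane embedding in which all vertices lie on the boundary of the unbounded face; it is maximal outerplanar if adding any new edge destroys outerplanarity. $\gamma(G)$ is the minimum size of a dominating set of $G$ (a set $X$ such that every vertex not in $X$ has a neighbor in $X$). A packing is a set of vertices with pairwise disjoint closed neighborhoods (equivalently, pairwise distance at least $3$); $\rho(G)$ is the maximum size of a packing. -}

module Defs where

open import Data.Nat using (ℕ; _<_; _≤ᵇ_)
import Data.Nat
open import Data.Bool using (Bool; true; false; _∨_; _∧_)
open import Data.Fin using (Fin; toℕ)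
open import Data.Fin.Properties using (_≟_)
open import Data.Fin.Subset using (Subset; _∈_; ∣_∣)
open import Data.Fin.Permutation using (Permutation′; _⟨$⟩ʳ_)
open import Data.Vec using (tabulate)
open import Data.Product using (Σ; ∃; _×_)
open import Data.Sum using (_⊎_)
open import Relation.Nullary using (¬_)
open import Relation.Nullary.Decidable using (⌊_⌋)
open import Relation.Binary.PropositionalEquality using (_≡_; _≢_)

record Graph (n : ℕ) : Set where
  field
    adj    : Fin n → Fin n → Bool
    sym    : ∀ u v → adj u v ≡ adj v u
    irrefl : ∀ v → adj v v ≡ false

open Graph public

AdjRel : ℕ → Set
AdjRel n = Fin n → Fin n → Bool

Adj : ∀ {n} → Graph n → Fin n → Fin n → Set
Adj G u v = adj G u v ≡ true

-- Chord with endpoints at positions i,j and chord with endpoints at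
-- positions k,l cross (interleave) on the circle.
Interleave : ℕ → ℕ → ℕ → ℕ → Set
Interleave i j k l = (i < k) × (k < j) × (j < l)

-- An outerplane drawing of the edge set E: the vertices are placed in a
-- cyclic order on a circle (vertex v at position toℕ (σ ⟨$⟩ʳ v)) and no
-- two edges, drawn as chords, cross.
OuterplanarRel : ∀ {n} → AdjRel n → Set
OuterplanarRel {n} E =
  Σ (Permutation′ n) λ σ →
    ∀ a b c d → E a b ≡ true → E c d ≡ true →
      ¬ Interleave (toℕ (σ ⟨$⟩ʳ a)) (toℕ (σ ⟨$⟩ʳ b))
                   (toℕ (σ ⟨$⟩ʳ c)) (toℕ (σ ⟨$⟩ʳ d))

Outerplanar : ∀ {n} → Graph n → Set
Outerplanar G = OuterplanarRel (adj G)

addEdge : ∀ {n} → Graph n → Fin n → Fin n → AdjRel n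
addEdge G u v x y =
  adj G x y ∨ ((⌊ x ≟ u ⌋ ∧ ⌊ y ≟ v ⌋) ∨ (⌊ x ≟ v ⌋ ∧ ⌊ y ≟ u ⌋))

MaximalOuterplanar : ∀ {n} → Graph n → Set
MaximalOuterplanar {n} G =
  Outerplanar G ×
  (∀ (u v : Fin n) → u ≢ v → adj G u v ≡ false →
     ¬ OuterplanarRel (addEdge G u v))

Dominating : ∀ {n} → Graph n → Subset n → Set
Dominating {n} G X =
  ∀ (v : Fin n) → ¬ (v ∈ X) → ∃ λ (u : Fin n) → (u ∈ X) × Adj G u v

InClosedNbhd : ∀ {n} → Graph n → Fin n → Fin n → Set
InClosedNbhd G v w = (w ≡ v) ⊎ Adj G v w

Packing : ∀ {n} → Graph n → Subset n → Set
Packing {n} G P =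
  ∀ (u v : Fin n) → u ∈ P → v ∈ P → u ≢ v →
    ¬ (∃ λ (w : Fin n) → InClosedNbhd G u w × InClosedNbhd G v w)

IsDominationNumber : ∀ {n} → Graph n → ℕ → Set
IsDominationNumber {n} G k =
  (∃ λ (X : Subset n) → Dominating G X × ∣ X ∣ ≡ k) ×
  (∀ (X : Subset n) → Dominating G X → k Data.Nat.≤ ∣ X ∣)

IsPackingNumber : ∀ {n} → Graph n → ℕ → Set
IsPackingNumber {n} G k =
  (∃ λ (P : Subset n) → Packing G P × ∣ P ∣ ≡ k) ×
  (∀ (P : Subset n) → Packing G P → ∣ P ∣ Data.Nat.≤ k)

degree : ∀ {n} → Graph n → Fin n → ℕ
degree G v = ∣ tabulate (adj G v) ∣

lowDegreeCount : ∀ {n} → Graph n → ℕ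
lowDegreeCount G = ∣ tabulate (λ v → degree G v ≤ᵇ 3) ∣

{-# OPTIONS --safe #-}
-- In fact γ ≤ 2ρ. Number the vertices along the outer cycle, and call i, j closed if no edge leaves
-- the open arc between them other than to i or j. Such an arc has an apex m, adjacent to both i
-- and j, that splits it into two closed arcs. Once the vertices inside these two are dominated, only
-- m can be left inside the arc; if it is, put m in the packing and i, j in the dominating set. An
-- undominated vertex at distance at most 2 from m lies inside the arc or is adjacent to i or j, so
-- none remains and all later packing vertices are far from m.
module Submission where

open import Defs renaming (sym to adj-sym)
open import Data.Nat using (ℕ; zero; suc; _≤_; _<_; _+_; _*_; s≤s; z≤n; _<?_; s≤s⁻¹)
open import Data.Nat.Properties hiding (_≟_; _<?_)
open import Data.Bool using (true; false)
import Data.Bool.Properties as Bool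
open import Data.Fin using (Fin; toℕ; fromℕ<)
open import Data.Fin.Properties
  using (_≟_; any?; toℕ<n; toℕ≤pred[n]; toℕ-injective; toℕ-fromℕ<)
open import Data.Fin.Permutation using (Permutation′; _⟨$⟩ʳ_; _⟨$⟩ˡ_; inverseˡ; inverseʳ)
open import Data.Fin.Subset using (Subset; _∈_; _∉_; _⊆_; _∪_; ⁅_⁆; ∣_∣; ⊥)
open import Data.Fin.Subset.Properties
  using (_∈?_; p⊆p∪q; q⊆p∪q; x∈p∪q⁻; x∈⁅x⁆; x∈⁅y⁆⇒x≡y; ∣⁅x⁆∣≡1; ∣⊥∣≡0; ∉⊥; p⊂q⇒∣p∣<∣q∣)
open import Data.Vec using ([]; _∷_)
open import Data.Product using (Σ; ∃; _×_; _,_; proj₁; proj₂)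
open import Data.Sum using (_⊎_; inj₁; inj₂)
open import Function using (_∘_)
open import Level using (Level)
open import Relation.Nullary using (¬_; Dec; yes; no; contradiction)
open import Relation.Nullary.Decidable using (_×-dec_; _⊎-dec_)
open import Relation.Unary using (Pred; Decidable)
open import Relation.Binary.PropositionalEquality
  using (_≡_; refl; sym; trans; cong; subst; subst₂)
open import Relation.Binary.Definitions using (tri<; tri≈; tri>)

private
  variable
    ℓ : Level
    n : ℕ

-- Cardinalities of subsets and maxima over a finite type.

∣p∪q∣≤∣p∣+∣q∣ : ∀ (p q : Subset n) → ∣ p ∪ q ∣ ≤ ∣ p ∣ + ∣ q ∣
∣p∪q∣≤∣p∣+∣q∣ [] [] = z≤n
∣p∪q∣≤∣p∣+∣q∣ (true ∷ p) (true ∷ q) =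
  s≤s (≤-trans (∣p∪q∣≤∣p∣+∣q∣ p q) (+-monoʳ-≤ ∣ p ∣ (n≤1+n ∣ q ∣)))
∣p∪q∣≤∣p∣+∣q∣ (true ∷ p) (false ∷ q) = s≤s (∣p∪q∣≤∣p∣+∣q∣ p q)
∣p∪q∣≤∣p∣+∣q∣ (false ∷ p) (true ∷ q) =
  ≤-trans (s≤s (∣p∪q∣≤∣p∣+∣q∣ p q)) (≤-reflexive (sym (+-suc ∣ p ∣ ∣ q ∣)))
∣p∪q∣≤∣p∣+∣q∣ (false ∷ p) (false ∷ q) = ∣p∪q∣≤∣p∣+∣q∣ p q

∣⁅i⁆∪⁅j⁆∣≤2 : ∀ (i j : Fin n) → ∣ ⁅ i ⁆ ∪ ⁅ j ⁆ ∣ ≤ 2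
∣⁅i⁆∪⁅j⁆∣≤2 i j = ≤-trans (∣p∪q∣≤∣p∣+∣q∣ ⁅ i ⁆ ⁅ j ⁆)
  (≤-reflexive (subst₂ (λ a b → a + b ≡ 2) (sym (∣⁅x⁆∣≡1 i)) (sym (∣⁅x⁆∣≡1 j)) refl))

x∉p⇒∣p∣<∣p∪⁅x⁆∣ : ∀ {p : Subset n} {x} → x ∉ p → ∣ p ∣ < ∣ p ∪ ⁅ x ⁆ ∣
x∉p⇒∣p∣<∣p∪⁅x⁆∣ {p = p} {x} x∉p =
  p⊂q⇒∣p∣<∣q∣ (p⊆p∪q ⁅ x ⁆ , x , q⊆p∪q p ⁅ x ⁆ (x∈⁅x⁆ x) , x∉p)

maximiser : {Q : Pred (Fin n) ℓ} → Decidable Q → (f : Fin n → ℕ) (b : ℕ) → (∀ x → f x ≤ b) →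
  ∃ Q → ∃ λ x → Q x × (∀ y → Q y → f y ≤ f x)
maximiser {Q = Q} Q? f b f≤b (x , qx) = search b x qx (m≤n+m b (f x))
  where
  -- `b ≤ f x + k` makes `k` a bound on the climb still possible; each move to a larger value costs
  -- one unit, and at `k = 0` none is left.
  search : ∀ k x → Q x → b ≤ f x + k → ∃ λ x → Q x × (∀ y → Q y → f y ≤ f x)
  search k x qx b≤ with any? (λ y → Q? y ×-dec (f x <? f y))
  ... | no none = x , qx , λ y qy → ≮⇒≥ (λ lt → none (y , qy , lt))
  search zero x qx b≤ | yes (y , qy , lt) =
    contradiction lt (≤⇒≯ (≤-trans (f≤b y) (≤-trans b≤ (≤-reflexive (+-identityʳ (f x))))))
  search (suc k) x qx b≤ | yes (y , qy , lt) =
    search k y qy (≤-trans b≤ (≤-trans (≤-reflexive (+-suc (f x) k)) (+-monoˡ-≤ k lt)))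

-- Growing a dominating set and a packing together.

module Greedy (G : Graph n) where

  Adj? : ∀ u v → Dec (Adj G u v)
  Adj? u v = adj G u v Bool.≟ true

  Adj-sym : ∀ {u v} → Adj G u v → Adj G v u
  Adj-sym {u} {v} = trans (adj-sym G v u)

  -- Distance at most 2, in exactly the form that `Packing` negates.
  Close : Fin n → Fin n → Set
  Close u v = ∃ λ w → InClosedNbhd G u w × InClosedNbhd G v w

  Close-refl : ∀ v → Close v v
  Close-refl v = v , inj₁ refl , inj₁ refl

  Close-sym : ∀ {u v} → Close u v → Close v u
  Close-sym (w , uw , vw) = w , vw , uw

  Dominated : Subset n → Fin n → Set
  Dominated D v = ∃ λ u → u ∈ D × InClosedNbhd G u v

  dominated? : ∀ D v → Dec (Dominated D v)
  dominated? D v = any? λ u → (u ∈? D) ×-dec ((v ≟ u) ⊎-dec Adj? u v)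

  Dominated-mono : ∀ {D E v} → D ⊆ E → Dominated D v → Dominated E v
  Dominated-mono D⊆E (u , u∈D , uv) = u , D⊆E u∈D , uv

  -- The invariant `far` lets any undominated vertex join the packing: it is at distance at least 3
  -- from every member of `P`.
  record State : Set where
    field
      D P     : Subset n
      size    : ∣ D ∣ ≤ 2 * ∣ P ∣
      packing : Packing G P
      far     : ∀ {p u} → p ∈ P → ¬ Dominated D u → ¬ Close p u

  open State

  initial : State
  initial = record
    { D = ⊥ ; P = ⊥
    ; size = ≤-trans (≤-reflexive (∣⊥∣≡0 n)) z≤n
    ; packing = λ u v u∈⊥ → contradiction u∈⊥ ∉⊥
    ; far = λ p∈⊥ → contradiction p∈⊥ ∉⊥ }

  -- If `v` is undominated, it joins `P` while `i` and `j` join `D`. The hypothesis on `i` and `j`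
  -- says that they dominate whatever undominated vertices are close to `v`, which restores `far`
  -- for the new member; `v`, being close to itself, is among those vertices.
  step : ∀ (s : State) v i j →
    (∀ u → ¬ Dominated (D s) u → Close v u → InClosedNbhd G i u ⊎ InClosedNbhd G j u) →
    Σ State λ t → D s ⊆ D t × Dominated (D t) v
  step s v i j near with dominated? (D s) v
  ... | yes dom = s , (λ x → x) , dom
  ... | no undom = t , D⊆D′ , by-ij v (near v undom (Close-refl v))
    where
    D′ P′ : Subset n
    D′ = D s ∪ (⁅ i ⁆ ∪ ⁅ j ⁆)
    P′ = P s ∪ ⁅ v ⁆

    D⊆D′ : D s ⊆ D′
    D⊆D′ = p⊆p∪q (⁅ i ⁆ ∪ ⁅ j ⁆)

    by-ij : ∀ u → InClosedNbhd G i u ⊎ InClosedNbhd G j u → Dominated D′ u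
    by-ij u (inj₁ iu) = i , q⊆p∪q (D s) _ (p⊆p∪q ⁅ j ⁆ (x∈⁅x⁆ i)) , iu
    by-ij u (inj₂ ju) = j , q⊆p∪q (D s) _ (q⊆p∪q ⁅ i ⁆ _ (x∈⁅x⁆ j)) , ju

    v∉P : v ∉ P s
    v∉P v∈P = far s v∈P undom (Close-refl v)

    packing′ : Packing G P′
    packing′ a b a∈ b∈ a≢b with x∈p∪q⁻ (P s) _ a∈ | x∈p∪q⁻ (P s) _ b∈
    ... | inj₁ a∈P | inj₁ b∈P = packing s a b a∈P b∈P a≢b
    ... | inj₁ a∈P | inj₂ b∈v rewrite x∈⁅y⁆⇒x≡y v b∈v = far s a∈P undom
    ... | inj₂ a∈v | inj₁ b∈P rewrite x∈⁅y⁆⇒x≡y v a∈v = far s b∈P undom ∘ Close-sym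
    ... | inj₂ a∈v | inj₂ b∈v =
      contradiction (trans (x∈⁅y⁆⇒x≡y v a∈v) (sym (x∈⁅y⁆⇒x≡y v b∈v))) a≢b

    far′ : ∀ {p u} → p ∈ P′ → ¬ Dominated D′ u → ¬ Close p u
    far′ {p} {u} p∈ undom′ close with x∈p∪q⁻ (P s) _ p∈
    ... | inj₁ p∈P = far s p∈P (undom′ ∘ Dominated-mono D⊆D′) close
    ... | inj₂ p∈v rewrite x∈⁅y⁆⇒x≡y v p∈v =
      undom′ (by-ij u (near u (undom′ ∘ Dominated-mono D⊆D′) close))

    size′ : ∣ D′ ∣ ≤ 2 * ∣ P′ ∣
    size′ = begin
      ∣ D′ ∣                        ≤⟨ ∣p∪q∣≤∣p∣+∣q∣ (D s) _ ⟩
      ∣ D s ∣ + ∣ ⁅ i ⁆ ∪ ⁅ j ⁆ ∣   ≤⟨ +-mono-≤ (size s) (∣⁅i⁆∪⁅j⁆∣≤2 i j) ⟩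
      2 * ∣ P s ∣ + 2               ≡⟨ +-comm (2 * ∣ P s ∣) 2 ⟩
      2 + 2 * ∣ P s ∣               ≡⟨ *-suc 2 ∣ P s ∣ ⟨
      -- `v` is new to `P`, because `far` would otherwise separate it from itself; this pays for the
      -- two vertices added to `D`.
      2 * suc ∣ P s ∣               ≤⟨ *-monoʳ-≤ 2 (x∉p⇒∣p∣<∣p∪⁅x⁆∣ v∉P) ⟩
      2 * ∣ P′ ∣                    ∎
      where open ≤-Reasoning

    t : State
    t = record { D = D′ ; P = P′ ; size = size′ ; packing = packing′ ; far = far′ }

  dominated⇒dominating : ∀ {D} → (∀ v → Dominated D v) → Dominating G D
  dominated⇒dominating dom v v∉D with dom v
  ... | u , u∈D , inj₁ refl = contradiction u∈D v∉D
  ... | u , u∈D , inj₂ uv = u , u∈D , uv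

-- Outerplane drawings and the edges forced by maximality.

addEdge⁻ : ∀ (G : Graph n) u v a b → addEdge G u v a b ≡ true →
  Adj G a b ⊎ ((a ≡ u × b ≡ v) ⊎ (a ≡ v × b ≡ u))
addEdge⁻ G u v a b e with adj G a b | a ≟ u | b ≟ v | a ≟ v | b ≟ u
... | true  | _ | _ | _ | _ = inj₁ refl
... | false | yes p | yes q | _ | _ = inj₂ (inj₁ (p , q))
... | false | yes p | no _ | yes r | yes s = inj₂ (inj₂ (r , s))
... | false | no _ | _ | yes r | yes s = inj₂ (inj₂ (r , s))
... | false | yes _ | no _ | yes _ | no _ = contradiction e λ ()
... | false | yes _ | no _ | no _ | _ = contradiction e λ ()
... | false | no _ | _ | yes _ | no _ = contradiction e λ ()
... | false | no _ | _ | no _ | _ = contradiction e λ ()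

module Drawing (G : Graph n) (maximal : MaximalOuterplanar G) where

  open Greedy G
  open State

  σ : Permutation′ n
  σ = proj₁ (proj₁ maximal)

  pos : Fin n → ℕ
  pos v = toℕ (σ ⟨$⟩ʳ v)

  pos-injective : ∀ {u v} → pos u ≡ pos v → u ≡ v
  pos-injective {u} {v} eq = trans (sym (inverseˡ σ))
    (trans (cong (σ ⟨$⟩ˡ_) (toℕ-injective eq)) (inverseˡ σ))

  at : ∀ k → k < n → ∃ λ v → pos v ≡ k
  at k k<n = σ ⟨$⟩ˡ fromℕ< k<n , trans (cong toℕ (inverseʳ σ)) (toℕ-fromℕ< k<n)

  Between : Fin n → Fin n → Fin n → Set
  Between i j v = pos i < pos v × pos v < pos j

  Beyond : Fin n → Fin n → Fin n → Set
  Beyond i j v = pos v < pos i ⊎ pos j < pos v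

  -- The drawing excludes interleaving in one order only; when `d` comes before `a`, it is applied
  -- with the two edges exchanged and `cd` reversed.
  noncrossing : ∀ {a b c d} → Adj G a b → Adj G c d → Between a b c → ¬ Beyond a b d
  noncrossing ab cd (a<c , c<b) (inj₁ d<a) =
    proj₂ (proj₁ maximal) _ _ _ _ (Adj-sym cd) ab (d<a , a<c , c<b)
  noncrossing ab cd (a<c , c<b) (inj₂ b<d) =
    proj₂ (proj₁ maximal) _ _ _ _ ab cd (a<c , c<b , b<d)

  Crossed : Fin n → Fin n → Set
  Crossed u v = ∃ λ c → ∃ λ d → Adj G c d × Between u v c × Beyond u v d

  crossed? : ∀ u v → Dec (Crossed u v)
  crossed? u v = any? λ c → any? λ d → Adj? c d
    ×-dec ((pos u <? pos c) ×-dec (pos c <? pos v))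
    ×-dec ((pos d <? pos u) ⊎-dec (pos v <? pos d))

  addEdge-forward : ∀ {u v a b} → pos u < pos v → pos a < pos b → addEdge G u v a b ≡ true →
    Adj G a b ⊎ (a ≡ u × b ≡ v)
  addEdge-forward {u} {v} {a} {b} u<v a<b e with addEdge⁻ G u v a b e
  ... | inj₁ ab = inj₁ ab
  ... | inj₂ (inj₁ eqs) = inj₂ eqs
  ... | inj₂ (inj₂ (refl , refl)) = contradiction a<b (<-asym u<v)

  -- The old order `σ` still works. Interleaving edges both run forward; two old ones are excluded
  -- by the drawing of `G`, an old one and the new one would witness `Crossed`, and the new edge
  -- does not interleave with itself.
  uncrossed⇒addable : ∀ {u v} → pos u < pos v → ¬ Crossed u v → OuterplanarRel (addEdge G u v)
  uncrossed⇒addable {u} {v} u<v unc = σ , λ a b c d ab cd (a<c , c<b , b<d) →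
    case (addEdge-forward u<v (<-trans a<c c<b) ab) (addEdge-forward u<v (<-trans c<b b<d) cd)
      a<c c<b b<d
    where
    case : ∀ {a b c d} → Adj G a b ⊎ (a ≡ u × b ≡ v) → Adj G c d ⊎ (c ≡ u × d ≡ v) →
      pos a < pos c → pos c < pos b → ¬ pos b < pos d
    case (inj₁ ab) (inj₁ cd) a<c c<b b<d =
      proj₂ (proj₁ maximal) _ _ _ _ ab cd (a<c , c<b , b<d)
    case (inj₁ ab) (inj₂ (refl , refl)) a<c c<b b<d =
      unc (_ , _ , Adj-sym ab , (c<b , b<d) , inj₁ a<c)
    case (inj₂ (refl , refl)) (inj₁ cd) a<c c<b b<d =
      unc (_ , _ , cd , (a<c , c<b) , inj₂ b<d)
    case (inj₂ (refl , refl)) (inj₂ (refl , refl)) a<c c<b b<d = <-irrefl refl a<c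

  -- Maximality enters here: a missing chord that nothing crosses could be added.
  uncrossed⇒adjacent : ∀ {u v} → pos u < pos v → ¬ Crossed u v → Adj G u v
  uncrossed⇒adjacent {u} {v} u<v unc = Bool.¬-not λ nonadj →
    proj₂ maximal u v (λ u≡v → <-irrefl (cong pos u≡v) u<v) nonadj (uncrossed⇒addable u<v unc)

  consecutive⇒adjacent : ∀ {u v} → pos v ≡ suc (pos u) → Adj G u v
  consecutive⇒adjacent eq = uncrossed⇒adjacent (≤-reflexive (sym eq))
    λ (c , d , _ , (u<c , c<v) , _) → <⇒≱ (subst (_ <_) eq c<v) u<c

  -- Closed arcs and the induction over them.

  -- Adjacency of `i` and `j` is not demanded: arcs under an edge are closed by `noncrossing`, and
  -- the arc from the first to the last position is closed because nothing lies beyond it.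
  Closed : Fin n → Fin n → Set
  Closed i j = ∀ {c d} → Adj G c d → Between i j c → ¬ Beyond i j d

  -- The last neighbour m of i before j: an edge crossing the chord mj would have to come from i, and
  -- would end after m.
  apex : ∀ {i j} → Closed i j → suc (pos i) < pos j →
    ∃ λ m → Between i j m × Adj G i m × Adj G m j
  apex {i} {j} closed i+1<j
    with at (suc (pos i)) (<-trans i+1<j (toℕ<n (σ ⟨$⟩ʳ j)))
  ... | k , pos-k with maximiser (λ v → Adj? i v ×-dec ((pos i <? pos v) ×-dec (pos v <? pos j)))
                      pos n (λ v → <⇒≤ (toℕ<n (σ ⟨$⟩ʳ v)))
                      (k , consecutive⇒adjacent pos-k ,
                       ≤-reflexive (sym pos-k) , subst (_< pos j) (sym pos-k) i+1<j)
  ... | m , (im , i<m , m<j) , last = m , (i<m , m<j) , im , uncrossed⇒adjacent m<j uncrossed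
    where
    uncrossed : ¬ Crossed m j
    uncrossed (c , d , cd , (m<c , c<j) , inj₂ j<d) = closed cd (<-trans i<m m<c , c<j) (inj₂ j<d)
    uncrossed (c , d , cd , (m<c , c<j) , inj₁ d<m) with <-cmp (pos d) (pos i)
    ... | tri< d<i _ _ = closed cd (<-trans i<m m<c , c<j) (inj₁ d<i)
    ... | tri≈ _ d≡i _ with refl ← pos-injective d≡i =
      <⇒≱ m<c (last c (Adj-sym cd , <-trans i<m m<c , c<j))
    ... | tri> _ _ i<d = noncrossing im (Adj-sym cd) (i<d , d<m) (inj₂ m<c)

  data Location (i j v : Fin n) : Set where
    left   : v ≡ i → Location i j v
    right  : v ≡ j → Location i j v
    inside : Between i j v → Location i j v

  locate : ∀ {i j v} → ¬ Beyond i j v → Location i j v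
  locate {i} {j} {v} ¬bey with <-cmp (pos i) (pos v) | <-cmp (pos v) (pos j)
  ... | tri> _ _ v<i | _ = contradiction (inj₁ v<i) ¬bey
  ... | _ | tri> _ _ j<v = contradiction (inj₂ j<v) ¬bey
  ... | tri≈ _ i≡v _ | _ = left (pos-injective (sym i≡v))
  ... | tri< _ _ _ | tri≈ _ v≡j _ = right (pos-injective v≡j)
  ... | tri< i<v _ _ | tri< v<j _ _ = inside (i<v , v<j)

  closed-neighbour : ∀ {i j c d} → Closed i j → Between i j c → InClosedNbhd G c d → Location i j d
  closed-neighbour closed in-c (inj₁ refl) = inside in-c
  closed-neighbour closed in-c (inj₂ cd) = locate (closed cd in-c)

  InClosedNbhd-sym : ∀ {u v} → InClosedNbhd G u v → InClosedNbhd G v u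
  InClosedNbhd-sym (inj₁ v≡u) = inj₁ (sym v≡u)
  InClosedNbhd-sym (inj₂ uv) = inj₂ (Adj-sym uv)

  -- Follow the path from `m` through `w` to `u`. A step from inside the arc stays inside or lands
  -- on an end, so either `w` is an end with `u` in its closed neighbourhood, or `u` itself lies in
  -- the arc or is an end.
  arc-near : ∀ {i j m u} → Closed i j → Between i j m → Close m u →
    (InClosedNbhd G i u ⊎ InClosedNbhd G j u) ⊎ Between i j u
  arc-near closed in-m (w , mw , uw) with closed-neighbour closed in-m mw
  ... | left refl = inj₁ (inj₁ (InClosedNbhd-sym uw))
  ... | right refl = inj₁ (inj₂ (InClosedNbhd-sym uw))
  ... | inside in-w with closed-neighbour closed in-w (InClosedNbhd-sym uw)
  ...   | left u≡i = inj₁ (inj₁ (inj₁ u≡i))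
  ...   | right u≡j = inj₁ (inj₂ (inj₁ u≡j))
  ...   | inside in-u = inj₂ in-u

  -- Induction on a bound `k` for the length of the arc. The state passes through the part left of
  -- the apex, then the part right of it, and last the apex; since `D` only grows, earlier
  -- domination survives.
  dominate-arc : ∀ k (s : State) {i j} → Closed i j → pos j ≤ pos i + k →
    Σ State λ t → D s ⊆ D t × (∀ v → Between i j v → Dominated (D t) v)
  dominate-arc zero s {i} closed j≤ = s , (λ x → x) , λ v (i<v , v<j) →
    contradiction (<-trans i<v v<j) (≤⇒≯ (≤-trans j≤ (≤-reflexive (+-identityʳ (pos i)))))
  dominate-arc (suc k) s {i} {j} closed j≤ with suc (pos i) <? pos j
  ... | no short = s , (λ x → x) , λ v (i<v , v<j) → contradiction (≤-<-trans i<v v<j) short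
  ... | yes i+1<j with apex closed i+1<j
  ... | m , in-m@(i<m , m<j) , im , mj
    -- Both parts are shorter by at least one, as `m` lies strictly between `i` and `j`.
    with dominate-arc k s {i} {m} (noncrossing im)
           (s≤s⁻¹ (≤-trans m<j (≤-trans j≤ (≤-reflexive (+-suc (pos i) k)))))
  ... | s₁ , s⊆s₁ , dom₁
    with dominate-arc k s₁ {m} {j} (noncrossing mj)
           (≤-trans j≤ (≤-trans (≤-reflexive (+-suc (pos i) k)) (+-monoˡ-≤ k i<m)))
  ... | s₂ , s₁⊆s₂ , dom₂ with step s₂ m i j near
    where
    -- Inside the arc only `m` can still be undominated, and it is a neighbour of `i`.
    near : ∀ u → ¬ Dominated (D s₂) u → Close m u → InClosedNbhd G i u ⊎ InClosedNbhd G j u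
    near u undom close with arc-near closed in-m close
    ... | inj₁ ij = ij
    ... | inj₂ (i<u , u<j) with <-cmp (pos u) (pos m)
    ...   | tri< u<m _ _ = contradiction (Dominated-mono s₁⊆s₂ (dom₁ u (i<u , u<m))) undom
    ...   | tri≈ _ u≡m _ with refl ← pos-injective u≡m = inj₁ (inj₂ im)
    ...   | tri> _ _ m<u = contradiction (dom₂ u (m<u , u<j)) undom
  ... | s₃ , s₂⊆s₃ , dom-m = s₃ , s₂⊆s₃ ∘ s₁⊆s₂ ∘ s⊆s₁ , dom
    where
    dom : ∀ v → Between i j v → Dominated (D s₃) v
    dom v (i<v , v<j) with <-cmp (pos v) (pos m)
    ... | tri< v<m _ _ = Dominated-mono (s₂⊆s₃ ∘ s₁⊆s₂) (dom₁ v (i<v , v<m))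
    ... | tri≈ _ v≡m _ with refl ← pos-injective v≡m = dom-m
    ... | tri> _ _ m<v = Dominated-mono s₂⊆s₃ (dom₂ v (m<v , v<j))

-- From the arc between the first and last positions to the whole graph.

γ≤2ρ : ∀ (G : Graph n) → MaximalOuterplanar G →
  ∀ {g r} → IsDominationNumber G g → IsPackingNumber G r → g ≤ 2 * r
γ≤2ρ {n = zero} G maximal (_ , g≤) _ = ≤-trans (g≤ [] λ ()) z≤n
γ≤2ρ {n = suc n} G maximal {g} {r} (_ , g≤) (_ , ≤r) = conclusion
  where
  open Greedy G
  open State
  open Drawing G maximal

  first : ∃ λ v → pos v ≡ 0
  first = at 0 (s≤s z≤n)

  last : ∃ λ v → pos v ≡ n
  last = at n ≤-refl

  i j : Fin (suc n)
  i = proj₁ first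
  j = proj₁ last

  nothing-beyond : ∀ {v} → ¬ Beyond i j v
  nothing-beyond {v} (inj₁ v<i) = n≮0 (subst (pos v <_) (proj₂ first) v<i)
  nothing-beyond {v} (inj₂ j<v) =
    <⇒≱ (subst (_< pos v) (proj₂ last) j<v) (toℕ≤pred[n] (σ ⟨$⟩ʳ v))

  -- With the interior dominated, an undominated vertex must be `i` or `j` itself, so the hypothesis
  -- of `step` holds whichever end is treated.
  ends : ∀ (s : State) → (∀ v → Between i j v → Dominated (D s) v) →
    ∀ u → ¬ Dominated (D s) u → InClosedNbhd G i u ⊎ InClosedNbhd G j u
  ends s dom u undom with locate (nothing-beyond {u})
  ... | left u≡i = inj₁ (inj₁ u≡i)
  ... | right u≡j = inj₂ (inj₁ u≡j)
  ... | inside in-u = contradiction (dom u in-u) undom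

  conclusion : g ≤ 2 * r
  conclusion
    -- There are `suc n` vertices, so the last position is `n` and `n` bounds the length of the arc.
    with dominate-arc n initial {i} {j} (λ _ _ → nothing-beyond)
           (≤-trans (≤-reflexive (proj₂ last)) (m≤n+m n (pos i)))
  ... | s₁ , _ , dom with step s₁ i i j (λ u undom _ → ends s₁ dom u undom)
  ... | s₂ , s₁⊆s₂ , dom-i
    with step s₂ j i j (λ u undom _ →
           ends s₂ (λ v in-v → Dominated-mono s₁⊆s₂ (dom v in-v)) u undom)
  -- `D s₃` dominates, hence has at least `g` elements, and `P s₃` is a packing, hence has at most
  -- `r`; `size` links the two.
  ... | s₃ , s₂⊆s₃ , dom-j = ≤-trans (g≤ (D s₃) (dominated⇒dominating all))
      (≤-trans (size s₃) (*-monoʳ-≤ 2 (≤r (P s₃) (packing s₃))))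
    where
    all : ∀ v → Dominated (D s₃) v
    all v with locate (nothing-beyond {v})
    ... | left refl = Dominated-mono s₂⊆s₃ dom-i
    ... | right refl = dom-j
    ... | inside in-v = Dominated-mono (s₂⊆s₃ ∘ s₁⊆s₂) (dom v in-v)

theorem6 : ∀ {n : ℕ} (G : Graph n) → MaximalOuterplanar G →
    ∀ (g r : ℕ) → IsDominationNumber G g → IsPackingNumber G r →
    (g ≤ 3 * r) × (4 * g ≤ 9 * r + lowDegreeCount G)
theorem6 G maximal g r γ ρ =
  ≤-trans g≤2r (*-monoˡ-≤ r (n≤1+n 2)) ,
  (begin
    4 * g                      ≤⟨ *-monoʳ-≤ 4 g≤2r ⟩
    4 * (2 * r)                ≡⟨ *-assoc 4 2 r ⟨
    8 * r                      ≤⟨ *-monoˡ-≤ r (n≤1+n 8) ⟩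
    9 * r                      ≤⟨ m≤m+n (9 * r) (lowDegreeCount G) ⟩
    9 * r + lowDegreeCount G   ∎)
  where
  open ≤-Reasoning
  g≤2r : g ≤ 2 * r
  g≤2r = γ≤2ρ G maximal γ ρ
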